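{- Let $k\ge 1$ and let $G$ be a connected graph. Then $G$ is well-hued with sequence $(2,4,6,\dots,2k)$ and chromatic number $k$ if and only if $G$ is (isomorphic to) a spanning subgraph of the complete $k$-partite graph $K_{2,\dots,2}$ (with $k$ parts of size $2$) such that for every $u\in V(G)$, the graph induced by $V(G)-N_G[u]$ is $\overline{K_2}$-free, i.e. contains no two distinct non-adjacent vertices.
   Context: All graphs are finite and simple. For $k\ge 1$, a maximal $k$-colorable subgraph of $G$ is a subgraph induced by a set $S\subseteq V(G)$ such that $G[S]$ is (properly) $k$-colorable and $G[S']$ is not $k$-colorable for every $S'$ with $S\subsetneq S'\subseteq V(G)$. $G$ is well-hued if for every $k\ge 1$ all maximal $k$-colorable subgraphs of $G$ have the same order, denoted $a_k$. The sequence of a well-hued graph $G$ is written $(a_1,a_2,\dots,a_{\chi(G)})$, where $a_{\chi(G)}=|V(G)|$ (and $a_j=|V(G)|$ for all $j\ge\chi(G)$). $N_G[u]$ denotes the closed neighborhood of $u$. -}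

module Defs where

open import Data.Fin.Base using (Fin; suc; toℕ)
open import Data.Fin.Properties using (_≟_)
open import Data.Fin.Subset using (Subset; _∈_; _⊂_; ∣_∣; ⁅_⁆; _∪_; ∁)
open import Data.Nat.Base as ℕ using (ℕ; _*_; _≤_)
open import Data.Product.Base using (Σ; ∃; ∃₂; _×_; proj₁)
open import Data.Vec.Base using (Vec; tabulate; lookup)
open import Function.Base using (_on_)
open import Function.Bundles using (_↔_; _⇔_; Inverse)
open import Level using (0ℓ)
open import Relation.Binary.Core using (Rel; _⇒_)
open import Relation.Binary.Construct.Closure.ReflexiveTransitive using (Star)
open import Relation.Binary.Definitions using (Decidable; Irreflexive; Symmetric)
open import Relation.Binary.PropositionalEquality using (_≡_; _≢_; refl; sym; cong)
open import Relation.Nullary.Decidable using (does; ¬?)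
open import Relation.Nullary.Negation using (¬_)

-- Simple graphs with vertex set V.  Adjacency is decidable, as it is
-- classically; a finite graph of order n is a Graph (Fin n).
record Graph (V : Set) : Set₁ where
  field
    Adj        : Rel V 0ℓ
    Adj-sym    : Symmetric Adj
    Adj-irrefl : Irreflexive _≡_ Adj
    Adj?       : Decidable Adj

open Graph

private
  variable
    n χ : ℕ
    V W : Set

Connected : Graph V → Set
Connected G = ∀ u v → Star (Adj G) u v

-- The vertices of G[S] are pairs (v , v∈S); v ∈ S is a proposition, so these
-- correspond exactly to the elements of S.
induced : Graph (Fin n) → (S : Subset n) → Graph (∃ λ v → v ∈ S)
induced G S = record
  { Adj        = Adj G on proj₁
  ; Adj-sym    = Adj-sym G
  ; Adj-irrefl = λ u≡v → Adj-irrefl G (cong proj₁ u≡v)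
  ; Adj?       = λ u v → Adj? G (proj₁ u) (proj₁ v)
  }

Colourable : Graph V → ℕ → Set
Colourable {V} G k = Σ (V → Fin k) λ c → ∀ u v → Adj G u v → c u ≢ c v

IsChromaticNumber : Graph V → ℕ → Set
IsChromaticNumber G k = Colourable G k × (∀ j → Colourable G j → k ≤ j)

MaximalColourable : Graph (Fin n) → ℕ → Subset n → Set
MaximalColourable G k S =
  Colourable (induced G S) k × (∀ S′ → S ⊂ S′ → ¬ Colourable (induced G S′) k)

WellHued : Graph (Fin n) → Set
WellHued G = ∀ k → 1 ≤ k → ∀ S T →
  MaximalColourable G k S → MaximalColourable G k T → ∣ S ∣ ≡ ∣ T ∣

IsCommonOrder : Graph (Fin n) → ℕ → ℕ → Set
IsCommonOrder G k a =
  ∃ (MaximalColourable G k) × (∀ S → MaximalColourable G k S → ∣ S ∣ ≡ a)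

-- Entry i of the vector, counting from 0, is a₍ᵢ₊₁₎; the length of the
-- sequence is the chromatic number.
record WellHuedWithSequence (G : Graph (Fin n)) (a : Vec ℕ χ) : Set where
  field
    wellHued  : WellHued G
    chromatic : IsChromaticNumber G χ
    orders    : ∀ (i : Fin χ) → IsCommonOrder G (ℕ.suc (toℕ i)) (lookup a i)

evens : ∀ k → Vec ℕ k
evens k = tabulate λ i → 2 * ℕ.suc (toℕ i)

completeMultipartite : ∀ k (size : Fin k → ℕ) → Graph (Σ (Fin k) λ i → Fin (size i))
completeMultipartite k size = record
  { Adj        = _≢_ on proj₁
  ; Adj-sym    = λ i≢j j≡i → i≢j (sym j≡i)
  ; Adj-irrefl = λ { refl i≢i → i≢i refl }
  ; Adj?       = λ u v → ¬? (proj₁ u ≟ proj₁ v)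
  }

record _≅_ (G : Graph V) (H : Graph W) : Set where
  field
    bijection : V ↔ W
    preserves : ∀ u v → Adj G u v ⇔ Adj H (Inverse.to bijection u) (Inverse.to bijection v)

SpanningSubgraph : Graph V → Graph V → Set
SpanningSubgraph H K = Adj H ⇒ Adj K

IsoToSpanningSubgraph : Graph V → Graph W → Set₁
IsoToSpanningSubgraph {W = W} G K =
  Σ (Graph W) λ H → SpanningSubgraph H K × G ≅ H

neighbourhood : Graph (Fin n) → Fin n → Subset n
neighbourhood G u = tabulate λ v → does (Adj? G u v)

closedNeighbourhood : Graph (Fin n) → Fin n → Subset n
closedNeighbourhood G u = ⁅ u ⁆ ∪ neighbourhood G u

K̄₂-Free : Graph V → Set
K̄₂-Free G = ¬ ∃₂ λ x y → x ≢ y × ¬ Adj G x y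

{-# OPTIONS --safe #-}

-- Say that G has α ≤ 2 if it has no three pairwise non-adjacent vertices.  Then
-- every colour class has at most two vertices, so a j-colourable set has at
-- most 2j vertices.  Both sides of the equivalence amount to: α ≤ 2, |V| = 2k,
-- and V splits into k pairs of non-adjacent vertices.  The essential point is
-- that then every j-colourable S with |S| < 2j ≤ |V| can be enlarged.  Some
-- colour class of S has at most one vertex.  If it is empty, give its colour to
-- a vertex outside S; if it is {x}, give its colour to the partner y of x.
-- When y lies outside S this enlarges S, and otherwise it increases the set of
-- vertices coloured like their partner, so the process terminates.  (This is an
-- augmenting path in the complement of G, traversed one edge at a time.)
module Submission where

open import Defs
open import Data.Bool.Base using (true; if_then_else_)
open import Data.Empty using (⊥; ⊥-elim)
open import Data.Fin.Base as Fin using (Fin; zero; suc; combine; remQuot; opposite; inject≤; fromℕ; toℕ)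
open import Data.Fin.Permutation using (↔⇒≡)
open import Data.Fin.Properties
  using (any?; _≟_; _<?_; <-cmp; <-irrefl; <-trans; ¬∀⟶∃¬; suc-injective; 0≢1+n; injective⇒≤;
         punchOut-injective; combine-injective; combine-remQuot; remQuot-combine; *↔×; opposite-involutive;
         inject≤-injective; toℕ-fromℕ; toℕ<n)
open import Data.Fin.Subset
  using (Subset; inside; outside; _∈_; _∉_; _⊂_; _⊃_; _⊆_; ∣_∣; ⁅_⁆; _∪_; ∁; ⊤) renaming (⊥ to ∅)
open import Data.Fin.Subset.Induction using (⊃-wellFounded; Acc; acc)
open import Data.Fin.Subset.Properties
  using (_∈?_; ∈⊤; ∉⊥; ∣p∣≤n; ∣⊤∣≡n; p⊆q⇒∣p∣≤∣q∣; p⊂q⇒∣p∣<∣q∣; x∈p⇒∣p-x∣<∣p∣; x∈p∧x≢y⇒x∈p-y;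
         x∈⁅x⁆; x∈⁅y⁆⇒x≡y; x∈p∪q⁺; x∈p∪q⁻; p⊆p∪q; x∉p⇒x∈∁p; x∈∁p⇒x∉p)
open import Data.Nat.Base using (ℕ; zero; suc; _*_; _≤_; _<_; z≤n; s≤s)
open import Data.Nat.Properties as ℕ using (*-comm; *-monoˡ-≤; *-cancelʳ-≤)
open import Data.Product.Base using (∃; ∃₂; _×_; _,_; proj₁; proj₂; map₂; uncurry)
open import Data.Sum.Base using (inj₁; inj₂; [_,_]′)
open import Data.Vec.Base using (lookup; tabulate; _∷_; here; there)
open import Data.Vec.Functional using (updateAt)
open import Data.Vec.Functional.Properties using (updateAt-updates; updateAt-minimal)
open import Data.Vec.Properties using ([]=⇒lookup; lookup⇒[]=; lookup∘tabulate)
open import Data.Vec.Properties.WithK using ([]=-irrelevant)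
open import Function.Base using (_∘_; const)
open import Function.Bundles using (_⇔_; _↔_; mk⇔; mk↔ₛ′; Inverse; Equivalence)
open import Function.Construct.Composition using (_↔-∘_)
open import Function.Construct.Symmetry using (↔-sym)
open import Function.Definitions using (Injective)
open import Relation.Binary.Definitions using (tri<; tri≈; tri>)
open import Relation.Binary.PropositionalEquality
  using (_≡_; _≢_; refl; sym; trans; cong; subst; subst₂; module ≡-Reasoning)
open import Relation.Nullary.Decidable using (Dec; yes; no; does; dec-true; decidable-stable; ¬?; _×-dec_)
open import Relation.Nullary.Negation using (¬_; contradiction)

open Graph

private
  variable
    m n j k : ℕ
    S T : Subset n
    u v w : Fin n

-- Finite sets

does≡true⇒ : {A : Set} (A? : Dec A) → does A? ≡ true → A
does≡true⇒ (yes a) _ = a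

module _ {P : Fin n → Set} (P? : ∀ i → Dec (P i)) where

  ∈-tabulate⁺ : P v → v ∈ tabulate (does ∘ P?)
  ∈-tabulate⁺ {v} Pv =
    lookup⇒[]= v _ (trans (lookup∘tabulate (does ∘ P?) v) (dec-true (P? v) Pv))

  ∈-tabulate⁻ : v ∈ tabulate (does ∘ P?) → P v
  ∈-tabulate⁻ {v} v∈ =
    does≡true⇒ (P? v) (trans (sym (lookup∘tabulate (does ∘ P?) v)) ([]=⇒lookup v∈))

∈-injective : {x y : ∃ λ v → v ∈ S} → proj₁ x ≡ proj₁ y → x ≡ y
∈-injective {x = v , p} {y = .v , q} refl = cong (v ,_) ([]=-irrelevant p q)

v∉S⇒S⊂S∪⁅v⁆ : v ∉ S → S ⊂ S ∪ ⁅ v ⁆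
v∉S⇒S⊂S∪⁅v⁆ {v = v} v∉S = p⊆p∪q _ , v , x∈p∪q⁺ (inj₂ (x∈⁅x⁆ v)) , v∉S

v∈S∪⁅w⁆⇒v∈S : v ≢ w → v ∈ S ∪ ⁅ w ⁆ → v ∈ S
v∈S∪⁅w⁆⇒v∈S {w = w} {S = S} v≢w v∈ =
  [ (λ v∈S → v∈S) , (λ v∈w → contradiction (x∈⁅y⁆⇒x≡y w v∈w) v≢w) ]′ (x∈p∪q⁻ S ⁅ w ⁆ v∈)

∣S∣<n⇒∃∉ : (S : Subset n) → ∣ S ∣ < n → ∃ λ v → v ∉ S
∣S∣<n⇒∃∉ {n} S ∣S∣<n = ¬∀⟶∃¬ n (_∈ S) (_∈? S) λ all → ℕ.<⇒≱ ∣S∣<n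
  (subst (_≤ ∣ S ∣) (∣⊤∣≡n n) (p⊆q⇒∣p∣≤∣q∣ {p = ⊤} λ {x} _ → all x))

enumerate : (S : Subset n) → Fin ∣ S ∣ → Fin n
enumerate (outside ∷ S) i       = suc (enumerate S i)
enumerate (inside  ∷ S) zero    = zero
enumerate (inside  ∷ S) (suc i) = suc (enumerate S i)

enumerate-∈ : (S : Subset n) → ∀ i → enumerate S i ∈ S
enumerate-∈ (outside ∷ S) i       = there (enumerate-∈ S i)
enumerate-∈ (inside  ∷ S) zero    = here
enumerate-∈ (inside  ∷ S) (suc i) = there (enumerate-∈ S i)

enumerate-injective : (S : Subset n) → Injective _≡_ _≡_ (enumerate S)
enumerate-injective (outside ∷ S) eq = enumerate-injective S (suc-injective eq)
enumerate-injective (inside  ∷ S) {zero}  {zero}  eq = refl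
enumerate-injective (inside  ∷ S) {suc _} {suc _} eq =
  cong suc (enumerate-injective S (suc-injective eq))

injectiveOn⇒∣S∣≤ : (f : Fin n → Fin m) →
  (∀ {u v} → u ∈ S → v ∈ S → f u ≡ f v → u ≡ v) → ∣ S ∣ ≤ m
injectiveOn⇒∣S∣≤ {S = S} f inj = injective⇒≤ {f = f ∘ enumerate S} λ eq →
  enumerate-injective S (inj (enumerate-∈ S _) (enumerate-∈ S _) eq)

injective⇒≤∣S∣ : (f : Fin m → Fin n) → Injective _≡_ _≡_ f → (∀ i → f i ∈ S) → m ≤ ∣ S ∣
injective⇒≤∣S∣ {zero}  f inj f∈S = z≤n
injective⇒≤∣S∣ {suc m} f inj f∈S = ℕ.≤-trans
  (s≤s (injective⇒≤∣S∣ (f ∘ suc) (suc-injective ∘ inj) λ i →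
    x∈p∧x≢y⇒x∈p-y (f∈S (suc i)) (λ eq → 0≢1+n (sym (inj eq)))))
  (x∈p⇒∣p-x∣<∣p∣ (f∈S zero))

-- Pigeonhole: a missed value `y` could be punched out of the codomain, giving an injection of
-- `Fin (suc n)` into `Fin n`.
injective⇒∃-preimage : m ≡ n → (f : Fin m → Fin n) → Injective _≡_ _≡_ f → ∀ y → ∃ λ x → f x ≡ y
injective⇒∃-preimage {n = suc n} refl f inj y with any? (λ x → f x ≟ y)
... | yes hit = hit
... | no miss = ⊥-elim (ℕ.1+n≰n (injective⇒≤ λ {a} {b} eq →
  inj (punchOut-injective {i = y} (miss ∘ (a ,_) ∘ sym) (miss ∘ (b ,_) ∘ sym) eq)))

injective⇒↔ : m ≡ n → (f : Fin m → Fin n) → Injective _≡_ _≡_ f → Fin m ↔ Fin n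
injective⇒↔ m≡n f inj = mk↔ₛ′ f (proj₁ ∘ preimage) (proj₂ ∘ preimage)
  (λ x → inj (proj₂ (preimage (f x))))
  where preimage = injective⇒∃-preimage m≡n f inj

remQuot-injective : ∀ m → Injective _≡_ _≡_ (remQuot {k} m)
remQuot-injective {k} m {x} {y} eq =
  trans (sym (combine-remQuot {k} m x)) (trans (cong (uncurry combine) eq) (combine-remQuot {k} m y))

-- Colourings

-- Colourings are total functions here, so that changing one colour or the set `S` needs no
-- transport between vertex types of induced graphs.
ColoursOn : Graph (Fin n) → Subset n → (Fin n → Fin k) → Set
ColoursOn G S c = ∀ {u v} → u ∈ S → v ∈ S → Adj G u v → c u ≢ c v

coloursOn⇒colourable : (G : Graph (Fin n)) (c : Fin n → Fin k) →
  ColoursOn G S c → Colourable (induced G S) k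
coloursOn⇒colourable G c proper = c ∘ proj₁ , λ (_ , u∈S) (_ , v∈S) → proper u∈S v∈S

colourable⇒coloursOn : (G : Graph (Fin n)) → Colourable (induced G S) (suc k) →
  ∃ λ (c : Fin n → Fin (suc k)) → ColoursOn G S c
colourable⇒coloursOn {n} {S} {k} G (c , proper) = c′ , proper′
  where
  c′ : Fin n → Fin (suc k)
  c′ v with v ∈? S
  ... | yes v∈S = c (v , v∈S)
  -- Colours off `S` are arbitrary, but one must exist; hence the palette `Fin (suc k)`.
  ... | no  _   = zero

  proper′ : ColoursOn G S c′
  proper′ {u} {v} u∈S v∈S adj with u ∈? S | v ∈? S
  ... | yes p | yes q = proper (u , p) (v , q) adj
  ... | no ¬p | _     = contradiction u∈S ¬p
  ... | _     | no ¬q = contradiction v∈S ¬q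

coloursOn-⊆ : (G : Graph (Fin n)) (c : Fin n → Fin k) → S ⊆ T → ColoursOn G T c → ColoursOn G S c
coloursOn-⊆ G c S⊆T proper u∈S v∈S = proper (S⊆T u∈S) (S⊆T v∈S)

colourable⇒induced : (G : Graph (Fin n)) → Colourable G k → Colourable (induced G S) k
colourable⇒induced G (c , proper) = c ∘ proj₁ , λ u v → proper (proj₁ u) (proj₁ v)

colourable-mono : {V : Set} {G : Graph V} → j ≤ k → Colourable G j → Colourable G k
colourable-mono j≤k (c , proper) =
  (λ v → inject≤ (c v) j≤k) , λ u v adj eq → proper u v adj (inject≤-injective j≤k j≤k _ _ eq)

-- Serves two moves: it adds `y` when `y` is outside `S` and recolours `y` when `y` is in `S`. Any
-- new conflict involves `y`, whose old colour is overwritten; hence the restriction `v ≢ y` in the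
-- condition on class `a`.
recolour : (G : Graph (Fin n)) (c : Fin n → Fin k) (y : Fin n) (a : Fin k) → ColoursOn G S c →
  (∀ {v} → v ∈ S → v ≢ y → c v ≡ a → ¬ Adj G v y) →
  ColoursOn G (S ∪ ⁅ y ⁆) (updateAt c y (const a))
recolour G c y a proper free {u} {v} u∈ v∈ adj eq with u ≟ y | v ≟ y
... | yes refl | yes refl = Adj-irrefl G refl adj
... | yes refl | no v≢y = free (v∈S∪⁅w⁆⇒v∈S v≢y v∈) v≢y
  (trans (sym (updateAt-minimal v y c v≢y)) (trans (sym eq) (updateAt-updates y c))) (Adj-sym G adj)
... | no u≢y | yes refl = free (v∈S∪⁅w⁆⇒v∈S u≢y u∈) u≢y
  (trans (sym (updateAt-minimal u y c u≢y)) (trans eq (updateAt-updates y c))) adj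
... | no u≢y | no v≢y = proper (v∈S∪⁅w⁆⇒v∈S u≢y u∈) (v∈S∪⁅w⁆⇒v∈S v≢y v∈) adj
  (trans (sym (updateAt-minimal u y c u≢y)) (trans eq (updateAt-minimal v y c v≢y)))

-- Pigeonhole: if every class held two distinct vertices of `S`, choosing such a pair in each class
-- would embed `Fin (k * 2)` in `S`.
sparse-class : (c : Fin n → Fin k) (S : Subset n) → ∣ S ∣ < k * 2 →
  ∃ λ a → ∀ {u v} → u ∈ S → v ∈ S → c u ≡ a → c v ≡ a → u ≡ v
sparse-class {n} {k} c S ∣S∣<2k =
  let a , ¬crowded = ¬∀⟶∃¬ k Crowded crowded? ¬all-crowded in
  a , λ {u} {v} u∈S v∈S cu≡a cv≡a → decidable-stable (u ≟ v) λ u≢v →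
    ¬crowded (u , v , u∈S , v∈S , u≢v , cu≡a , cv≡a)
  where
  Crowded : Fin k → Set
  Crowded a = ∃₂ λ u v → u ∈ S × v ∈ S × u ≢ v × c u ≡ a × c v ≡ a

  crowded? : ∀ a → Dec (Crowded a)
  crowded? a = any? λ u → any? λ v →
    u ∈? S ×-dec v ∈? S ×-dec ¬? (u ≟ v) ×-dec c u ≟ a ×-dec c v ≟ a

  ¬all-crowded : ¬ (∀ a → Crowded a)
  ¬all-crowded crowded = ℕ.<⇒≱ ∣S∣<2k (injective⇒≤∣S∣ (pick ∘ remQuot 2)
    (λ eq → remQuot-injective {k} 2 (pick-injective _ _ eq)) (λ i → pick-∈ (remQuot 2 i)))
    where
    pick : Fin k × Fin 2 → Fin n
    pick (a , zero)     = proj₁ (crowded a)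
    pick (a , suc zero) = proj₁ (proj₂ (crowded a))

    pick-∈ : ∀ s → pick s ∈ S
    pick-∈ (a , zero)     = let _ , _ , u∈S , _ = crowded a in u∈S
    pick-∈ (a , suc zero) = let _ , _ , _ , v∈S , _ = crowded a in v∈S

    c∘pick : ∀ s → c (pick s) ≡ proj₁ s
    c∘pick (a , zero)     = let _ , _ , _ , _ , _ , cu≡a , _ = crowded a in cu≡a
    c∘pick (a , suc zero) = let _ , _ , _ , _ , _ , _ , cv≡a = crowded a in cv≡a

    pick-injective : ∀ s t → pick s ≡ pick t → s ≡ t
    -- Equal picks have equal colours, hence come from the same class; within it, `u≢v` separates
    -- the two choices.
    pick-injective s@(a , _) t@(b , _) eq
      with refl ← trans (sym (c∘pick s)) (trans (cong c eq) (c∘pick t)) = cases _ _ eq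
      where
      u≢v = let _ , _ , _ , _ , u≢v , _ = crowded a in u≢v

      cases : ∀ x y → pick (a , x) ≡ pick (a , y) → (a , x) ≡ (a , y)
      cases zero       zero       _  = refl
      cases zero       (suc zero) eq = contradiction eq u≢v
      cases (suc zero) zero       eq = contradiction (sym eq) u≢v
      cases (suc zero) (suc zero) _  = refl

-- Independence number at most two

α≤2 : Graph (Fin n) → Set
α≤2 G = ∀ {x y z} → x ≢ y → x ≢ z → y ≢ z →
  ¬ Adj G x y → ¬ Adj G x z → ¬ Adj G y z → ⊥

module Slots (G : Graph (Fin n)) (α : α≤2 G)
             (S : Subset n) (c : Fin n → Fin k) (proper : ColoursOn G S c) where

  Earlier : Fin n → Set
  Earlier v = ∃ λ w → w Fin.< v × w ∈ S × c w ≡ c v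

  earlier? : ∀ v → Dec (Earlier v)
  earlier? v = any? λ w → w <? v ×-dec w ∈? S ×-dec c w ≟ c v

  side : Fin n → Fin 2
  side v = if does (earlier? v) then suc zero else zero

  -- A class meets `S` in at most two vertices, so its colour and one bit, telling whether a smaller
  -- vertex of `S` shares that colour, identify a vertex of `S`. Besides bounding `∣ S ∣`, this map
  -- later places the vertices of `G` in parts of size two.
  slot : Fin n → Fin (k * 2)
  slot v = combine (c v) (side v)

  -- The vertex `u` itself is an earlier classmate of `v`. If `u` had one too, say `w`, then `w`,
  -- `u`, `v` would be three pairwise non-adjacent vertices.
  side-≢ : u ∈ S → v ∈ S → u Fin.< v → c u ≡ c v → side u ≢ side v
  side-≢ {u} {v} u∈S v∈S u<v cu≡cv eq with earlier? u | earlier? v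
  ... | _ | no ¬e = ¬e (u , u<v , u∈S , cu≡cv)
  side-≢ _ _ _ _ () | no _ | yes _
  ... | yes (w , w<u , w∈S , cw≡cu) | yes _ = α
    (λ w≡u → <-irrefl w≡u w<u) (λ w≡v → <-irrefl w≡v (<-trans w<u u<v)) (λ u≡v → <-irrefl u≡v u<v)
    (λ adj → proper w∈S u∈S adj cw≡cu)
    (λ adj → proper w∈S v∈S adj (trans cw≡cu cu≡cv))
    (λ adj → proper u∈S v∈S adj cu≡cv)

  slot-injective : u ∈ S → v ∈ S → slot u ≡ slot v → u ≡ v
  slot-injective {u} {v} u∈S v∈S eq with combine-injective (c u) (side u) (c v) (side v) eq
  ... | cu≡cv , side≡ with <-cmp u v
  ...   | tri< u<v _ _ = contradiction side≡ (side-≢ u∈S v∈S u<v cu≡cv)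
  ...   | tri≈ _ u≡v _ = u≡v
  ...   | tri> _ _ v<u = contradiction (sym side≡) (side-≢ v∈S u∈S v<u (sym cu≡cv))

  ∣S∣≤k*2 : ∣ S ∣ ≤ k * 2
  ∣S∣≤k*2 = injectiveOn⇒∣S∣≤ slot slot-injective

module _ (G : Graph (Fin n)) where

  ∈∁closedNeighbourhood⁺ : v ≢ u → ¬ Adj G u v → v ∈ ∁ (closedNeighbourhood G u)
  ∈∁closedNeighbourhood⁺ {v} {u} v≢u ¬adj = x∉p⇒x∈∁p λ v∈ →
    [ v≢u ∘ x∈⁅y⁆⇒x≡y u , ¬adj ∘ ∈-tabulate⁻ (Adj? G u) ]′ (x∈p∪q⁻ ⁅ u ⁆ _ v∈)

  ∈∁closedNeighbourhood⁻ : v ∈ ∁ (closedNeighbourhood G u) → v ≢ u × ¬ Adj G u v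
  ∈∁closedNeighbourhood⁻ {v} {u} v∈∁ =
    (λ { refl → x∈∁p⇒x∉p v∈∁ (x∈p∪q⁺ (inj₁ (x∈⁅x⁆ u))) }) ,
    (λ adj → x∈∁p⇒x∉p v∈∁ (x∈p∪q⁺ {p = ⁅ u ⁆} (inj₂ (∈-tabulate⁺ (Adj? G u) adj))))

  -- The condition on the non-neighbours of `u` is `α≤2` with `u` singled out as one vertex of the
  -- triple; the converse below reads it the other way.
  α≤2⇒K̄₂-Free : α≤2 G → ∀ u → K̄₂-Free (induced G (∁ (closedNeighbourhood G u)))
  α≤2⇒K̄₂-Free α u ((x , x∈) , (y , y∈) , x≢y , ¬xy) =
    let x≢u , ¬ux = ∈∁closedNeighbourhood⁻ x∈
        y≢u , ¬uy = ∈∁closedNeighbourhood⁻ y∈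
    in α (x≢u ∘ sym) (y≢u ∘ sym) (x≢y ∘ ∈-injective) ¬ux ¬uy ¬xy

  K̄₂-Free⇒α≤2 : (∀ u → K̄₂-Free (induced G (∁ (closedNeighbourhood G u)))) → α≤2 G
  K̄₂-Free⇒α≤2 free {x} {y} {z} x≢y x≢z y≢z ¬xy ¬xz ¬yz = free x
    ( (y , ∈∁closedNeighbourhood⁺ (x≢y ∘ sym) ¬xy)
    , (z , ∈∁closedNeighbourhood⁺ (x≢z ∘ sym) ¬xz)
    , (y≢z ∘ cong proj₁)
    , ¬yz )

  -- Morally, `S` extends to a maximal colourable set, which has order `a`. No such set is
  -- constructed: if `∣ S ∣` exceeded `a`, induction on supersets would exclude every larger
  -- colourable set, so `S` itself would be maximal and have order `a`. This avoids deciding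
  -- colourability.
  commonOrder⇒∣S∣≤ : ∀ {a} → IsCommonOrder G k a → ∀ S → Colourable (induced G S) k → ∣ S ∣ ≤ a
  commonOrder⇒∣S∣≤ {k} {a} (_ , order) S col = bound S (⊃-wellFounded S) col
    where
    bound : ∀ S → Acc _⊃_ S → Colourable (induced G S) k → ∣ S ∣ ≤ a
    bound S (acc larger) col = decidable-stable (∣ S ∣ ℕ.≤? a) λ S≰a →
      S≰a (ℕ.≤-reflexive (order S (col , λ T S⊂T colT →
        S≰a (ℕ.<⇒≤ (ℕ.<-≤-trans (p⊂q⇒∣p∣<∣q∣ S⊂T) (bound T (larger S⊂T) colT))))))

  -- An independent triple would be a 1-colourable set of order 3, exceeding the common order 2.
  commonOrder⇒α≤2 : IsCommonOrder G 1 2 → α≤2 G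
  commonOrder⇒α≤2 order {x} {y} {z} x≢y x≢z y≢z ¬xy ¬xz ¬yz =
    ℕ.<⇒≱ (injective⇒≤∣S∣ vertex (vertex-injective _ _) (∈-tabulate⁺ vertex? ∘ (_, refl)))
      (commonOrder⇒∣S∣≤ order _ (coloursOn⇒colourable G (const zero) λ u∈ v∈ adj _ →
        independent (∈-tabulate⁻ vertex? u∈) (∈-tabulate⁻ vertex? v∈) adj))
    where
    vertex : Fin 3 → Fin n
    vertex zero             = x
    vertex (suc zero)       = y
    vertex (suc (suc zero)) = z

    vertex? : ∀ v → Dec (∃ λ i → vertex i ≡ v)
    vertex? v = any? λ i → vertex i ≟ v

    vertex-injective : ∀ s t → vertex s ≡ vertex t → s ≡ t
    vertex-injective zero             zero             _  = refl
    vertex-injective zero             (suc zero)       eq = contradiction eq x≢y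
    vertex-injective zero             (suc (suc zero)) eq = contradiction eq x≢z
    vertex-injective (suc zero)       zero             eq = contradiction (sym eq) x≢y
    vertex-injective (suc zero)       (suc zero)       _  = refl
    vertex-injective (suc zero)       (suc (suc zero)) eq = contradiction eq y≢z
    vertex-injective (suc (suc zero)) zero             eq = contradiction (sym eq) x≢z
    vertex-injective (suc (suc zero)) (suc zero)       eq = contradiction (sym eq) y≢z
    vertex-injective (suc (suc zero)) (suc (suc zero)) _  = refl

    ¬adj : ∀ s t → ¬ Adj G (vertex s) (vertex t)
    ¬adj zero             zero             = Adj-irrefl G refl
    ¬adj zero             (suc zero)       = ¬xy
    ¬adj zero             (suc (suc zero)) = ¬xz
    ¬adj (suc zero)       zero             = ¬xy ∘ Adj-sym G
    ¬adj (suc zero)       (suc zero)       = Adj-irrefl G refl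
    ¬adj (suc zero)       (suc (suc zero)) = ¬yz
    ¬adj (suc (suc zero)) zero             = ¬xz ∘ Adj-sym G
    ¬adj (suc (suc zero)) (suc zero)       = ¬yz ∘ Adj-sym G
    ¬adj (suc (suc zero)) (suc (suc zero)) = Adj-irrefl G refl

    independent : (∃ λ i → vertex i ≡ u) → (∃ λ i → vertex i ≡ v) → ¬ Adj G u v
    independent (s , refl) (t , refl) = ¬adj s t

  maximal⇒full : Colourable G k → MaximalColourable G k S → ∣ S ∣ ≡ n
  maximal⇒full {S = S} col (_ , maximal) = ℕ.≤-antisym (∣p∣≤n S) (ℕ.≮⇒≥ λ ∣S∣<n →
    let v , v∉S = ∣S∣<n⇒∃∉ S ∣S∣<n in
    maximal ⊤ ((λ _ → ∈⊤) , v , ∈⊤ , v∉S) (colourable⇒induced G col))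

-- Enlarging colourable sets

-- A perfect matching of the complement of `G`, encoded as a fixed-point-free involution.
record NonAdjacentPairing (G : Graph (Fin n)) : Set where
  field
    partner            : Fin n → Fin n
    partner-involutive : ∀ v → partner (partner v) ≡ v
    partner-≢          : ∀ v → partner v ≢ v
    partner-¬adj       : ∀ v → ¬ Adj G v (partner v)

module _ (G : Graph (Fin n)) (pairing : NonAdjacentPairing G) where
  open NonAdjacentPairing pairing

  matched? : (c : Fin n → Fin k) (S : Subset n) (v : Fin n) →
    Dec (v ∈ S × partner v ∈ S × c v ≡ c (partner v))
  matched? c S v = v ∈? S ×-dec partner v ∈? S ×-dec c v ≟ c (partner v)

  matched : (c : Fin n → Fin k) → Subset n → Subset n
  matched c S = tabulate (does ∘ matched? c S)

  -- As `x` is alone in class `a`, its partner had another colour, so `x` becomes matched only now.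
  -- Recolouring the partner can affect no pair but its own, which was unmatched, so no matched
  -- vertex is lost.
  matched-⊂ : ∀ (c : Fin n → Fin k) {x a} → x ∈ S → partner x ∈ S → c x ≡ a →
    (∀ {v} → v ∈ S → c v ≡ a → v ≡ x) →
    matched c S ⊂ matched (updateAt c (partner x) (const a)) S
  matched-⊂ {k} {S} c {x} {a} x∈S y∈S cx≡a only =
    (λ v∈M → ∈-tabulate⁺ (matched? c′ S) (keep (∈-tabulate⁻ (matched? c S) v∈M))) ,
    x , ∈-tabulate⁺ (matched? c′ S) (x∈S , y∈S , c′x≡c′y) ,
    λ x∈M → let _ , _ , cx≡cy = ∈-tabulate⁻ (matched? c S) x∈M in cy≢a (trans (sym cx≡cy) cx≡a)
    where
    y = partner x

    c′ : Fin n → Fin k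
    c′ = updateAt c y (const a)

    cy≢a : c y ≢ a
    cy≢a cy≡a = partner-≢ x (only y∈S cy≡a)

    c′x≡c′y : c′ x ≡ c′ y
    c′x≡c′y = trans (updateAt-minimal x y c (partner-≢ x ∘ sym)) (trans cx≡a (sym (updateAt-updates y c)))

    keep : ∀ {v} → v ∈ S × partner v ∈ S × c v ≡ c (partner v) →
      v ∈ S × partner v ∈ S × c′ v ≡ c′ (partner v)
    keep {v} (v∈S , pv∈S , cv≡cpv) = v∈S , pv∈S , (begin
      c′ v           ≡⟨ updateAt-minimal v y c v≢y ⟩
      c v            ≡⟨ cv≡cpv ⟩
      c (partner v)  ≡⟨ updateAt-minimal (partner v) y c pv≢y ⟨
      c′ (partner v) ∎)
      where
      open ≡-Reasoning
      v≢y : v ≢ y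
      v≢y refl = cy≢a (trans cv≡cpv (trans (cong c (partner-involutive x)) cx≡a))

      pv≢y : partner v ≢ y
      pv≢y pv≡y = cy≢a (trans (cong c (sym pv≡y)) (trans (sym cv≡cpv) (trans (cong c v≡x) cx≡a)))
        where
        v≡x : v ≡ x
        v≡x = trans (sym (partner-involutive v)) (trans (cong partner pv≡y) (partner-involutive x))

  Enlargeable : ℕ → Subset n → Set
  Enlargeable k S = ∃ λ T → S ⊂ T × Colourable (induced G T) k

  enlarge-with : ∀ (c : Fin n → Fin k) {y a} → y ∉ S → ColoursOn G S c →
    (∀ {v} → v ∈ S → v ≢ y → c v ≡ a → ¬ Adj G v y) → Enlargeable k S
  enlarge-with c y∉S proper free =
    _ , v∉S⇒S⊂S∪⁅v⁆ y∉S , coloursOn⇒colourable G _ (recolour G c _ _ proper free)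

  -- The set `S` stays fixed through the recursion and only `c` changes, so growth of `matched c S`
  -- is the sole termination measure.
  coloursOn⇒enlargeable : ∣ S ∣ < k * 2 → k * 2 ≤ n → (c : Fin n → Fin k) →
    Acc _⊃_ (matched c S) → ColoursOn G S c → Enlargeable k S
  coloursOn⇒enlargeable {S} {k} small 2k≤n c (acc larger) proper
    with sparse-class c S small
  ... | a , sparse with any? (λ x → x ∈? S ×-dec c x ≟ a)
  ... | no empty = enlarge-with c (proj₂ (∣S∣<n⇒∃∉ S (ℕ.<-≤-trans small 2k≤n))) proper
    λ {v} v∈S _ cv≡a → contradiction (v , v∈S , cv≡a) empty
  ... | yes (x , x∈S , cx≡a) with partner x ∈? S
  ...   | no y∉S = enlarge-with c y∉S proper λ v∈S _ cv≡a →
    subst (λ v → ¬ Adj G v (partner x)) (sparse x∈S v∈S cx≡a cv≡a) (partner-¬adj x)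
  -- The recoloured partner already lies in `S`, so the colouring of the union is restricted back to
  -- `S`.
  ...   | yes y∈S = coloursOn⇒enlargeable small 2k≤n _
    (larger (matched-⊂ c x∈S y∈S cx≡a λ v∈S cv≡a → sparse v∈S x∈S cv≡a cx≡a))
    (coloursOn-⊆ G _ (p⊆p∪q _) (recolour G c (partner x) a proper λ v∈S _ cv≡a →
      subst (λ v → ¬ Adj G v (partner x)) (sparse x∈S v∈S cx≡a cv≡a) (partner-¬adj x)))

  colourable⇒enlargeable : ∣ S ∣ < suc k * 2 → suc k * 2 ≤ n →
    Colourable (induced G S) (suc k) → Enlargeable (suc k) S
  colourable⇒enlargeable small 2k≤n col =
    let c , proper = colourable⇒coloursOn G col in
    coloursOn⇒enlargeable small 2k≤n c (⊃-wellFounded _) proper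

  large-colourable : suc k * 2 ≤ n → ∃ λ T → Colourable (induced G T) (suc k) × suc k * 2 ≤ ∣ T ∣
  large-colourable {k} 2k≤n =
    grow ∅ (⊃-wellFounded ∅) (const zero , λ (_ , v∈∅) → contradiction v∈∅ ∉⊥)
    where
    grow : ∀ S → Acc _⊃_ S → Colourable (induced G S) (suc k) →
      ∃ λ T → Colourable (induced G T) (suc k) × suc k * 2 ≤ ∣ T ∣
    grow S (acc larger) col with suc k * 2 ℕ.≤? ∣ S ∣
    ... | yes big  = S , col , big
    ... | no small =
      let T , S⊂T , colT = colourable⇒enlargeable (ℕ.≰⇒> small) 2k≤n col in grow T (larger S⊂T) colT

  module _ (α : α≤2 G) where

    colourable⇒∣S∣≤ : ∀ S → Colourable (induced G S) (suc k) → ∣ S ∣ ≤ suc k * 2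
    colourable⇒∣S∣≤ S col =
      let c , proper = colourable⇒coloursOn G col in Slots.∣S∣≤k*2 G α S c proper

    maximal⇒∣S∣≡ : suc k * 2 ≤ n → ∀ S → MaximalColourable G (suc k) S → ∣ S ∣ ≡ suc k * 2
    maximal⇒∣S∣≡ 2k≤n S (col , maximal) = ℕ.≤-antisym (colourable⇒∣S∣≤ S col) (ℕ.≮⇒≥ λ small →
      let T , S⊂T , colT = colourable⇒enlargeable small 2k≤n col in maximal T S⊂T colT)

    -- A colourable set that attains the upper bound `suc k * 2` has no larger colourable superset;
    -- this gives existence of a maximal one.
    commonOrder : suc k * 2 ≤ n → IsCommonOrder G (suc k) (suc k * 2)
    commonOrder 2k≤n = let T , colT , big = large-colourable 2k≤n in
      (T , colT , λ U T⊂U colU →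
        ℕ.<⇒≱ (p⊂q⇒∣p∣<∣q∣ T⊂U) (ℕ.≤-trans (colourable⇒∣S∣≤ U colU) big)) ,
      maximal⇒∣S∣≡ 2k≤n

    -- A colouring with `j` colours covers at most `j * 2` vertices, and there are `k * 2`. The
    -- bound is taken from `Slots` directly, since `j` may be 0.
    α≤2⇒chromatic : n ≡ k * 2 → Colourable G k → IsChromaticNumber G k
    α≤2⇒chromatic {k} n≡2k col = col , λ j (c , proper) → *-cancelʳ-≤ k j 2
      (subst (_≤ j * 2) (trans (∣⊤∣≡n n) n≡2k)
        (Slots.∣S∣≤k*2 G α ⊤ c λ {u} {v} _ _ → proper u v))

    -- With at most `k` colours, enlargement fixes the order of maximal sets; with more, `G` itself
    -- is colourable and every maximal set is the whole vertex set.
    α≤2⇒wellHued : n ≡ k * 2 → Colourable G k → WellHued G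
    α≤2⇒wellHued {k} n≡2k col (suc j) _ S T maxS maxT with suc j ℕ.≤? k
    ... | yes 1+j≤k = trans (maximal⇒∣S∣≡ bound S maxS) (sym (maximal⇒∣S∣≡ bound T maxT))
      where bound = subst (suc j * 2 ≤_) (sym n≡2k) (*-monoˡ-≤ 2 1+j≤k)
    ... | no 1+j≰k = trans (maximal⇒full G colⱼ maxS) (sym (maximal⇒full G colⱼ maxT))
      where colⱼ = colourable-mono {G = G} (ℕ.≰⇒≥ 1+j≰k) col

    α≤2⇒sequence : n ≡ k * 2 → Colourable G k → WellHuedWithSequence G (evens k)
    α≤2⇒sequence {k} n≡2k col = record
      { wellHued  = α≤2⇒wellHued n≡2k col
      ; chromatic = α≤2⇒chromatic n≡2k col
      ; orders    = λ i → subst (IsCommonOrder G (suc (toℕ i)))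
          (trans (*-comm (suc (toℕ i)) 2) (sym (lookup∘tabulate _ i)))
          (commonOrder (subst (suc (toℕ i) * 2 ≤_) (sym n≡2k) (*-monoˡ-≤ 2 (toℕ<n i))))
      }

-- Spanning subgraphs of the complete multipartite graph, and the equivalence

module _ (G : Graph (Fin n)) where

  module _ (iso : IsoToSpanningSubgraph G (completeMultipartite k (λ _ → 2))) where
    private
      H        = proj₁ iso
      spanning = proj₁ (proj₂ iso)
      open _≅_ (proj₂ (proj₂ iso))
      open Inverse bijection using (to; from; strictlyInverseˡ; strictlyInverseʳ)

    iso⇒adj⇒≢ : Adj G u v → proj₁ (to u) ≢ proj₁ (to v)
    iso⇒adj⇒≢ {u} {v} adj = spanning (Equivalence.to (preserves u v) adj)

    iso⇒colourable : Colourable G k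
    iso⇒colourable = proj₁ ∘ to , λ _ _ → iso⇒adj⇒≢

    iso⇒order : n ≡ k * 2
    iso⇒order = ↔⇒≡ (↔-sym (*↔× {k} {2}) ↔-∘ bijection)

    -- The partner of a vertex is the other vertex of its part, reached by `opposite` on `Fin 2`;
    -- vertices of one part are never adjacent.
    iso⇒pairing : NonAdjacentPairing G
    iso⇒pairing = record
      { partner            = partner
      ; partner-involutive = λ v → trans
          (cong (from ∘ swap) (strictlyInverseˡ (swap (to v))))
          (trans (cong (λ b → from (proj₁ (to v) , b)) (opposite-involutive (proj₂ (to v))))
            (strictlyInverseʳ v))
      ; partner-≢          = λ v eq → opposite-≢ (proj₂ (to v))
          (cong proj₂ (trans (sym (strictlyInverseˡ (swap (to v)))) (cong to eq)))
      ; partner-¬adj       = λ v adj →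
          iso⇒adj⇒≢ adj (sym (cong proj₁ (strictlyInverseˡ (swap (to v)))))
      }
      where
      swap : Fin k × Fin 2 → Fin k × Fin 2
      swap = map₂ opposite

      partner : Fin n → Fin n
      partner = from ∘ swap ∘ to

      opposite-≢ : ∀ (b : Fin 2) → opposite b ≢ b
      opposite-≢ zero       ()
      opposite-≢ (suc zero) ()

  -- Since `n ≡ k * 2`, the injective map `slot` is a bijection. Its first coordinate is the colour,
  -- so colour classes become the parts, and `H` is `G` transported along it.
  α≤2⇒iso : α≤2 G → n ≡ k * 2 → Colourable G k →
    IsoToSpanningSubgraph G (completeMultipartite k (λ _ → 2))
  α≤2⇒iso {k} α n≡2k (c , proper) = H , spanning , record
    { bijection = bijection
    ; preserves = λ u v → mk⇔
        (subst₂ (Adj G) (sym (strictlyInverseʳ u)) (sym (strictlyInverseʳ v)))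
        (subst₂ (Adj G) (strictlyInverseʳ u) (strictlyInverseʳ v))
    }
    where
    open Slots G α ⊤ c (λ {u} {v} _ _ → proper u v)
      using (slot; slot-injective; side)

    bijection : Fin n ↔ (Fin k × Fin 2)
    bijection = *↔× ↔-∘ injective⇒↔ n≡2k slot (slot-injective ∈⊤ ∈⊤)

    open Inverse bijection using (to; from; strictlyInverseˡ; strictlyInverseʳ)

    H : Graph (Fin k × Fin 2)
    H = record
      { Adj        = λ s t → Adj G (from s) (from t)
      ; Adj-sym    = Adj-sym G
      ; Adj-irrefl = λ s≡t → Adj-irrefl G (cong from s≡t)
      ; Adj?       = λ s t → Adj? G (from s) (from t)
      }

    spanning : SpanningSubgraph H (completeMultipartite k (λ _ → 2))
    spanning {s} {t} adj s₁≡t₁ = proper (from s) (from t) adj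
      (trans (c∘from s) (trans s₁≡t₁ (sym (c∘from t))))
      where
      proj₁∘to : ∀ v → proj₁ (to v) ≡ c v
      proj₁∘to v = cong proj₁ (remQuot-combine (c v) (side v))

      c∘from : ∀ s → c (from s) ≡ proj₁ s
      c∘from s = trans (sym (proj₁∘to (from s))) (cong proj₁ (strictlyInverseˡ s))

theorem4 : ∀ (k : ℕ) → 1 ≤ k → ∀ (n : ℕ) (G : Graph (Fin n)) → Connected G →
    (WellHuedWithSequence G (evens k) × IsChromaticNumber G k)
    ⇔
    (IsoToSpanningSubgraph G (completeMultipartite k (λ _ → 2)) × (∀ (u : Fin n) → K̄₂-Free (induced G (∁ (closedNeighbourhood G u)))))
theorem4 k@(suc k-1) _ n G _ = mk⇔
  -- Only the first and last entries of the sequence enter: `orders zero` says that `a₁` is 2, and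
  -- `order` reads off `n` from the last.
  (λ (hued , _) → let open WellHuedWithSequence hued
                      α = commonOrder⇒α≤2 G (orders zero)
                  in α≤2⇒iso G α (order hued) (proj₁ chromatic) , α≤2⇒K̄₂-Free G α)
  (λ (iso , free) → let α       = K̄₂-Free⇒α≤2 G free
                        pairing = iso⇒pairing G iso
                        n≡2k    = iso⇒order G iso
                        col     = iso⇒colourable G iso
                    in α≤2⇒sequence G pairing α n≡2k col , α≤2⇒chromatic G pairing α n≡2k col)
  where
  -- As `G` is `k`-colourable, the whole vertex set is a maximal `k`-colourable set, so `n` equals
  -- the last entry. That entry has index `k-1`, because indices start at 0.
  order : WellHuedWithSequence G (evens k) → n ≡ k * 2
  order hued = begin
    n                     ≡⟨ ∣⊤∣≡n n ⟨
    ∣ ⊤ {n} ∣             ≡⟨ proj₂ (orders last) ⊤ ⊤-maximal ⟩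
    lookup (evens k) last ≡⟨ lookup∘tabulate (λ i → 2 * suc (toℕ i)) last ⟩
    2 * suc (toℕ last)    ≡⟨ cong (λ i → 2 * suc i) (toℕ-fromℕ k-1) ⟩
    2 * k                 ≡⟨ *-comm 2 k ⟩
    k * 2                 ∎
    where
    open WellHuedWithSequence hued
    open ≡-Reasoning

    last : Fin k
    last = fromℕ k-1

    ⊤-maximal : MaximalColourable G (suc (toℕ last)) ⊤
    ⊤-maximal =
      colourable⇒induced G
        (subst (Colourable G) (cong suc (sym (toℕ-fromℕ k-1))) (proj₁ chromatic)) ,
      λ _ (_ , _ , _ , v∉⊤) → contradiction ∈⊤ v∉⊤
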